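{- For every integer $a>0$, the sequence $(\mathcal{G}(a,b))_{b\ge a}$ of Sprague-Grundy values of 2-Star Nim is ultimately additively periodic; that is, there exist integers $n_0\ge a$ and $p\ge 1$ such that $\mathcal{G}(a,b+p)=\mathcal{G}(a,b)+p$ for all $b\ge n_0$.
   Context: 2-Star Nim: a position is a pair $(a,b)$ of nonnegative integers, not both $0$ (one token on square $a$ of a first strip and one on square $b$ of a second strip, the two strips sharing their square $0$, which holds at most one token). A move replaces exactly one coordinate by a smaller nonnegative integer, provided the result is not $(0,0)$. A player unable to move loses. $\mathcal{G}(a,b)$ is the Sprague-Grundy value, $\mathcal{G}(p)=\operatorname{mex}\{\mathcal{G}(q): q\text{ reachable from }p\text{ in one move}\}$, where $\operatorname{mex}(S)$ is the least nonnegative integer not in $S$. -}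

module Defs where

open import Data.Fin using (Fin; toℕ; fromℕ<)
open import Data.Fin.Properties using (toℕ<n; toℕ-fromℕ<)
open import Data.List using (List; _++_; allFin; map; mapMaybe)
open import Data.List.Membership.Propositional using (_∈_)
open import Data.List.Membership.Propositional.Properties using (∈-allFin; ∈-map⁻)
open import Data.List.Properties using (map-cong)
open import Data.List.Relation.Unary.Any as Any using (Any; here; there)
open import Data.List.Relation.Unary.Any.Properties using (++⁺ˡ; ++⁺ʳ; mapMaybe⁺; map⁺)
open import Data.Maybe using (Maybe; just; nothing)
open import Data.Maybe.Relation.Unary.Any as MAny using (just)
open import Data.Nat using (ℕ; zero; suc; _+_; _≤_; _<_; _>_; z≤n; s≤s; _≟_)
open import Data.Nat.Induction using (<-wellFounded)
open import Data.Nat.ListAction using (sum)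
open import Data.Nat.Properties using (m≤m+n; m≤n⇒m≤o+n; n≮n; m<n⇒n≢0; +-monoˡ-<; +-monoʳ-<)
open import Data.List.Membership.DecPropositional _≟_ using (_∈?_)
open import Data.Product using (∃; _×_; _,_; proj₁; proj₂)
open import Function using (_∘_; flip; _on_)
open import Induction.WellFounded using (Acc; acc; WellFounded; module Subrelation)
import Relation.Binary.Construct.On as On
open import Relation.Binary.PropositionalEquality using (_≡_; refl; sym; trans; cong; subst)
open import Relation.Nullary using (¬_; Dec; yes; no; ¬?; contradiction; contradiction-irr)
open import Relation.Nullary.Decidable using (_×-dec_)
open import Relation.Unary using (Decidable)

Least : (ℕ → Set) → ℕ → Set
Least P m = P m × (∀ n → P n → m ≤ n)

IsMex : (ℕ → Set) → ℕ → Set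
IsMex S = Least (λ n → ¬ S n)

search : {P : ℕ → Set} → Decidable P → ∀ n → P n → ∃ (Least P)
search P? n Pn with P? 0
search P? n       Pn | yes P0 = 0 , P0 , λ _ _ → z≤n
search P? zero    P0 | no ¬P0 = contradiction P0 ¬P0
search P? (suc n) Pn | no ¬P0 with search (P? ∘ suc) n Pn
... | m , Pm , least = suc m , Pm , λ where
  zero    P0 → contradiction P0 ¬P0
  (suc k) Pk → s≤s (least k Pk)

∈⇒≤sum : ∀ {n ns} → n ∈ ns → n ≤ sum ns
∈⇒≤sum (here refl)           = m≤m+n _ _
∈⇒≤sum (there {x = m} n∈ns) = m≤n⇒m≤o+n m (∈⇒≤sum n∈ns)

mex-spec : ∀ ns → ∃ (IsMex (_∈ ns))
mex-spec ns = search (λ n → ¬? (n ∈? ns)) (suc (sum ns)) (n≮n _ ∘ ∈⇒≤sum)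

mex : List ℕ → ℕ
mex ns = proj₁ (mex-spec ns)

NonOrigin : ℕ → ℕ → Set
NonOrigin a b = ¬ (a ≡ 0 × b ≡ 0)

nonOrigin? : ∀ a b → Dec (NonOrigin a b)
nonOrigin? a b = ¬? (a ≟ 0 ×-dec b ≟ 0)

a>0⇒nonOrigin : ∀ {a b} → a > 0 → NonOrigin a b
a>0⇒nonOrigin a>0 (a≡0 , _) = m<n⇒n≢0 a>0 a≡0

-- One token per strip.  The strips share their square 0, which holds at most
-- one token, so (0 , 0) is excluded.  The proof field is irrelevant so that
-- positions with equal coordinates are definitionally equal.
record Position : Set where
  constructor position
  field
    left right : ℕ
    .nonOrigin : NonOrigin left right

open Position

infix 4 _⟶_

data _⟶_ (p q : Position) : Set where
  moveˡ : left q < left p → right q ≡ right p → p ⟶ q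
  moveʳ : left q ≡ left p → right q < right p → p ⟶ q

⟶-wellFounded : WellFounded (flip _⟶_)
⟶-wellFounded =
  Subrelation.wellFounded decreases (On.wellFounded tokens <-wellFounded)
  where
  tokens : Position → ℕ
  tokens p = left p + right p

  decreases : ∀ {q p} → p ⟶ q → (_<_ on tokens) q p
  decreases {p = position _ b _} (moveˡ l refl) = +-monoˡ-< b l
  decreases {p = position a _ _} (moveʳ refl l) = +-monoʳ-< a l

tryˡ : ∀ p → Fin (left p) → Maybe (∃ (p ⟶_))
tryˡ p i with nonOrigin? (toℕ i) (right p)
... | yes ok = just (position (toℕ i) (right p) ok , moveˡ (toℕ<n i) refl)
... | no _   = nothing

tryʳ : ∀ p → Fin (right p) → Maybe (∃ (p ⟶_))
tryʳ p i with nonOrigin? (left p) (toℕ i)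
... | yes ok = just (position (left p) (toℕ i) ok , moveʳ refl (toℕ<n i))
... | no _   = nothing

moves : ∀ p → List (∃ (p ⟶_))
moves p = mapMaybe (tryˡ p) (allFin (left p))
       ++ mapMaybe (tryʳ p) (allFin (right p))

𝒢-acc : ∀ p → Acc (flip _⟶_) p → ℕ
𝒢-acc p (acc rs) = mex (map (λ (q , m) → 𝒢-acc q (rs m)) (moves p))

𝒢 : Position → ℕ
𝒢 p = 𝒢-acc p (⟶-wellFounded p)

position-≡ : ∀ {p q} → left p ≡ left q → right p ≡ right q → p ≡ q
position-≡ refl refl = refl

tryˡ-legal : ∀ p i .(o : NonOrigin (toℕ i) (right p)) →
  MAny.Any (λ m → proj₁ m ≡ position (toℕ i) (right p) o) (tryˡ p i)
tryˡ-legal p i o with nonOrigin? (toℕ i) (right p)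
... | yes _  = just refl
... | no ¬o = contradiction-irr o ¬o

tryʳ-legal : ∀ p i .(o : NonOrigin (left p) (toℕ i)) →
  MAny.Any (λ m → proj₁ m ≡ position (left p) (toℕ i) o) (tryʳ p i)
tryʳ-legal p i o with nonOrigin? (left p) (toℕ i)
... | yes _  = just refl
... | no ¬o = contradiction-irr o ¬o

moves-complete : ∀ {p q} → p ⟶ q → Any (λ m → proj₁ m ≡ q) (moves p)
moves-complete {p} {position a b o} (moveˡ a<left refl) =
  ++⁺ˡ (mapMaybe⁺ (tryˡ p) (allFin (left p))
    (map⁺ (Any.map (λ { refl → legal }) (∈-allFin i))))
  where
  i = fromℕ< a<left
  i≡a = toℕ-fromℕ< a<left
  legal : MAny.Any (λ m → proj₁ m ≡ position a b o) (tryˡ p i)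
  legal = MAny.map (λ eq → trans eq (position-≡ i≡a refl))
    (tryˡ-legal p i (subst (λ x → NonOrigin x b) (sym i≡a) o))
moves-complete {p} {position a b o} (moveʳ refl b<right) =
  ++⁺ʳ (mapMaybe (tryˡ p) (allFin (left p)))
    (mapMaybe⁺ (tryʳ p) (allFin (right p))
      (map⁺ (Any.map (λ { refl → legal }) (∈-allFin i))))
  where
  i = fromℕ< b<right
  i≡b = toℕ-fromℕ< b<right
  legal : MAny.Any (λ m → proj₁ m ≡ position a b o) (tryʳ p i)
  legal = MAny.map (λ eq → trans eq (position-≡ refl i≡b))
    (tryʳ-legal p i (subst (NonOrigin a) (sym i≡b) o))

-- 𝒢 satisfies the recurrence defining the Sprague-Grundy function.

𝒢-acc-irrelevant : ∀ p (r s : Acc (flip _⟶_) p) → 𝒢-acc p r ≡ 𝒢-acc p s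
𝒢-acc-irrelevant p (acc rs) (acc ss) = cong mex
  (map-cong (λ (q , m) → 𝒢-acc-irrelevant q (rs m) (ss m)) (moves p))

𝒢-acc-unfold : ∀ p (r : Acc (flip _⟶_) p) →
  𝒢-acc p r ≡ mex (map (𝒢 ∘ proj₁) (moves p))
𝒢-acc-unfold p (acc rs) = cong mex
  (map-cong (λ (q , m) → 𝒢-acc-irrelevant q (rs m) (⟶-wellFounded q)) (moves p))

𝒢-spec : ∀ p → IsMex (λ n → ∃ λ q → p ⟶ q × 𝒢 q ≡ n) (𝒢 p)
𝒢-spec p = subst (IsMex _) (sym (𝒢-acc-unfold p (⟶-wellFounded p)))
  (proj₁ spec ∘ to , λ n n∉ → proj₂ spec n (n∉ ∘ from))
  where
  values = map (𝒢 ∘ proj₁) (moves p)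
  spec = proj₂ (mex-spec values)

  to : ∀ {n} → (∃ λ q → p ⟶ q × 𝒢 q ≡ n) → n ∈ values
  to (q , m , refl) = map⁺ (Any.map (λ { refl → refl }) (moves-complete m))

  from : ∀ {n} → n ∈ values → ∃ λ q → p ⟶ q × 𝒢 q ≡ n
  from n∈ with ∈-map⁻ (𝒢 ∘ proj₁) n∈
  ... | (q , m) , _ , refl = q , m , refl

{-# OPTIONS --safe #-}

-- Suppose finitely many sequences f i stay within K of the diagonal and satisfy
-- f i (b + p) ≡ f i b + p from n on, and let g be the next row, filled greedily.
-- Then g stays within D = 2K + 1 of the diagonal, so at column b the set of values
-- already used by g contains everything below b ∸ D and nothing from b + D on: up
-- to translation by b it is one of finitely many states.  Two columns congruent
-- modulo p with the same state make g additively periodic, with a period that is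
-- a multiple of p.

module Submission where

open import Defs
open import Data.Fin using (Fin; toℕ; fromℕ<; funToFin; finToFun)
open import Data.Fin.Properties
  using (toℕ<n; toℕ-fromℕ<; toℕ-injective; fromℕ<-injective; injective⇒≤; pigeonhole; finToFun-funToFin)
open import Data.Nat using (ℕ; zero; suc; _+_; _*_; _^_; _∸_; _≤_; _<_; _≥_; _>_; z≤n; s≤s; _≟_; _≤?_; _<?_)
open import Data.Nat.Induction using (<-rec)
open import Data.Nat.Properties
open import Data.Nat.Tactic.RingSolver using (solve-∀)
open import Data.Product using (∃; ∃₂; ∃-syntax; _×_; _,_; proj₁; proj₂)
open import Data.Sum as Sum using (_⊎_; inj₁; inj₂)
open import Function using (_∘_; case_of_; _⇔_; mk⇔; Equivalence)
open import Relation.Binary.Definitions using (tri<; tri≈; tri>)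
open import Relation.Binary.PropositionalEquality
  using (_≡_; _≢_; refl; sym; trans; cong; subst; subst₂; module ≡-Reasoning)
open import Relation.Nullary using (¬_; Dec; yes; no; contradiction; contradiction-irr)
open import Relation.Nullary.Decidable using (decidable-stable)

open Equivalence using (to; from)

-- Sequences near the diagonal that are additively periodic.

record Tame (n p K : ℕ) (f : ℕ → ℕ) : Set where
  field
    upper    : ∀ b → f b ≤ b + K
    lower    : ∀ b → b ≤ f b + K
    periodic : ∀ b → n ≤ b → f (b + p) ≡ f b + p

open Tame

periodic-multiple : ∀ {n p K f} → Tame n p K f →
  ∀ k b → n ≤ b → f (b + p * k) ≡ f b + p * k
periodic-multiple {p = p} {f = f} t zero b n≤b
  rewrite *-zeroʳ p | +-identityʳ b | +-identityʳ (f b) = refl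
periodic-multiple {p = p} {f = f} t (suc k) b n≤b = begin
  f (b + p * suc k)   ≡⟨ cong f (split b) ⟩
  f (b + p * k + p)   ≡⟨ periodic t _ (m≤n⇒m≤n+o _ n≤b) ⟩
  f (b + p * k) + p   ≡⟨ cong (_+ p) (periodic-multiple t k b n≤b) ⟩
  f b + p * k + p     ≡⟨ split (f b) ⟨
  f b + p * suc k     ∎
  where
  open ≡-Reasoning
  split : ∀ x → x + p * suc k ≡ x + p * k + p
  split x = trans (cong (x +_) (trans (*-suc p k) (+-comm p (p * k))))
    (sym (+-assoc x (p * k) p))

-- Brings the older rows to the start, period and bound found for a new row, so that one triple
-- serves them all.
tame-weaken : ∀ {n n′ p K K′ f} k → n ≤ n′ → K ≤ K′ →
  Tame n p K f → Tame n′ (p * k) K′ f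
tame-weaken k n≤n′ K≤K′ t = record
  { upper    = λ b → ≤-trans (upper t b) (+-monoʳ-≤ b K≤K′)
  ; lower    = λ b → ≤-trans (lower t b) (+-monoʳ-≤ _ K≤K′)
  ; periodic = λ b n′≤b → periodic-multiple t k b (≤-trans n≤n′ n′≤b)
  }

swapʳ : ∀ x y z → x + y + z ≡ x + z + y
swapʳ = solve-∀

-- Repetition among finitely many states.

code : ∀ {P : Set} → Dec P → Fin 2
code (yes _) = Fin.zero
code (no _)  = Fin.suc Fin.zero

code-≡⇒⇔ : ∀ {P Q : Set} (P? : Dec P) (Q? : Dec Q) → code P? ≡ code Q? → P ⇔ Q
code-≡⇒⇔ (yes p) (yes q) _ = mk⇔ (λ _ → q) (λ _ → p)
code-≡⇒⇔ (no ¬p) (no ¬q) _ = mk⇔ (λ p → contradiction p ¬p) (λ q → contradiction q ¬q)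

-- Each time carries a vector of `w` bits, encoded as an element of `Fin (2 ^ w)`; pigeonhole
-- applies to the first `2 ^ w + 1` times.
state-repeats : {R : ℕ → ℕ → Set} → (∀ t k → Dec (R t k)) → ∀ w →
  ∃₂ λ i j → i < j × (∀ k → k < w → R i k ⇔ R j k)
state-repeats {R} R? w =
  let i , j , i<j , eq = pigeonhole (n<1+n (2 ^ w)) (λ t → funToFin (state (toℕ t)))
  in toℕ i , toℕ j , i<j , λ k k<w →
    subst (λ k → R (toℕ i) k ⇔ R (toℕ j) k) (toℕ-fromℕ< k<w)
      (code-≡⇒⇔ (R? _ _) (R? _ _) (begin
        state (toℕ i) (fromℕ< k<w)                         ≡⟨ finToFun-funToFin (state (toℕ i)) _ ⟨
        finToFun (funToFin (state (toℕ i))) (fromℕ< k<w)   ≡⟨ cong (λ c → finToFun c (fromℕ< k<w)) eq ⟩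
        finToFun (funToFin (state (toℕ j))) (fromℕ< k<w)   ≡⟨ finToFun-funToFin (state (toℕ j)) _ ⟩
        state (toℕ j) (fromℕ< k<w)                         ∎))
  where
  open ≡-Reasoning
  state : ℕ → Fin w → Fin 2
  state t k = code (R? t (toℕ k))

-- A greedily filled row stays near the diagonal.

Blocked : {I : Set} → (I → ℕ → ℕ) → ℕ → ℕ → Set
Blocked f b v = ∃ λ i → f i b ≡ v

Earlier : (ℕ → ℕ) → ℕ → ℕ → Set
Earlier g b v = ∃ λ b′ → b′ < b × g b′ ≡ v

earlier? : ∀ g b v → Dec (Earlier g b v)
earlier? g b v = anyUpTo? (λ b′ → g b′ ≟ v) b

earlier-suc⁻ : ∀ {g b v} → Earlier g (suc b) v → Earlier g b v ⊎ g b ≡ v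
earlier-suc⁻ (b′ , b′<1+b , eq) with m<1+n⇒m<n∨m≡n b′<1+b
... | inj₁ b′<b = inj₁ (b′ , b′<b , eq)
... | inj₂ refl = inj₂ eq

earlier-suc⁺ : ∀ {g b v} → Earlier g b v ⊎ g b ≡ v → Earlier g (suc b) v
earlier-suc⁺ (inj₁ (b′ , b′<b , eq)) = b′ , m<n⇒m<1+n b′<b , eq
earlier-suc⁺ (inj₂ eq)               = _ , ≤-refl , eq

module Greedy
  {I : Set} {n p K : ℕ} {f : I → ℕ → ℕ} (tame : ∀ i → Tame n p K (f i))
  (g : ℕ → ℕ)
  (fresh   : ∀ {b′ b} → b′ < b → g b′ ≢ g b)
  (avoids  : ∀ {b} → n ≤ b → ¬ Blocked f b (g b))
  (minimal : ∀ {b v} → ¬ Earlier g b v → ¬ Blocked f b v → g b ≤ v)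
  where

  g-injective : ∀ {b b′} → g b ≡ g b′ → b ≡ b′
  g-injective {b} {b′} eq with <-cmp b b′
  ... | tri< b<b′ _ _ = contradiction eq (fresh b<b′)
  ... | tri≈ _ b≡b′ _ = b≡b′
  ... | tri> _ _ b′<b = contradiction (sym eq) (fresh b′<b)

  blocked-upper : ∀ {b v} → Blocked f b v → v ≤ b + K
  blocked-upper (i , refl) = upper (tame i) _

  blocked-lower : ∀ {b v} → Blocked f b v → b ≤ v + K
  blocked-lower (i , refl) = lower (tame i) _

  blocked-shift : ∀ k {b v} → n ≤ b → Blocked f b v ⇔ Blocked f (b + p * k) (v + p * k)
  blocked-shift k {b} {v} n≤b = mk⇔
    (λ (i , eq) → i , trans (periodic-multiple (tame i) k b n≤b) (cong (_+ p * k) eq))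
    (λ (i , eq) → i , +-cancelʳ-≡ (p * k) _ _ (trans (sym (periodic-multiple (tame i) k b n≤b)) eq))

  -- At most this many columns, those from `v - K` to `v + K`, can block a given value `v`.
  D : ℕ
  D = suc (K + K)

  -- `suc (b + K)` is always a candidate: blocked values reach only `b + K`, and by induction
  -- earlier entries are smaller than it.
  g≤1+b+K : ∀ b → g b ≤ suc (b + K)
  g≤1+b+K = <-rec _ λ b rec → minimal
    (λ (b′ , b′<b , eq) → <-irrefl eq (≤-<-trans (rec b′<b) (s≤s (+-monoˡ-< K b′<b))))
    (n≮n _ ∘ blocked-upper)

  K<D : K < D
  K<D = s≤s (m≤m+n K K)

  g-upper : ∀ b → g b ≤ b + D
  g-upper b = ≤-trans (g≤1+b+K b) (+-monoʳ-< b K<D)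

  -- Only columns within K of v can block v; col v enumerates columns
  -- outside that range.
  col : ℕ → ℕ → ℕ
  col v k with k + K <? v
  ... | yes _ = k
  ... | no _  = k + D

  col-bound : ∀ {v k} → k ≤ v → col v k ≤ v + D
  col-bound {v} {k} k≤v with k + K <? v
  ... | yes _ = m≤n⇒m≤n+o D k≤v
  ... | no _  = +-monoˡ-≤ D k≤v

  k+D≡1+k+K+K : ∀ k → k + D ≡ suc (k + K + K)
  k+D≡1+k+K+K k = trans (+-suc k (K + K)) (cong suc (sym (+-assoc k K K)))

  col-unblocked : ∀ v k → ¬ Blocked f (col v k) v
  col-unblocked v k bl with k + K <? v
  ... | yes k+K<v = <⇒≱ k+K<v (blocked-upper bl)
  -- From `v ≤ k + K`, column `k + D` lies beyond `v + K`.
  ... | no k+K≮v  = <⇒≱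
    (≤-trans (s≤s (+-monoˡ-≤ K (≮⇒≥ k+K≮v))) (≤-reflexive (sym (k+D≡1+k+K+K k))))
    (blocked-lower bl)

  col-injective : ∀ {v} k l → col v k ≡ col v l → k ≡ l
  col-injective {v} k l eq with k + K <? v | l + K <? v
  ... | yes _     | yes _     = eq
  -- Here `k ≡ l + D`, so `l ≤ k` and `l` would pass the test that `k` passes.
  ... | yes k+K<v | no l+K≮v  =
    contradiction (≤-<-trans (+-monoˡ-≤ K (m+n≤o⇒m≤o l (≤-reflexive (sym eq)))) k+K<v) l+K≮v
  ... | no k+K≮v  | yes l+K<v =
    contradiction (≤-<-trans (+-monoˡ-≤ K (m+n≤o⇒m≤o k (≤-reflexive eq))) l+K<v) k+K≮v
  ... | no _      | no _      = +-cancelʳ-≡ D k l eq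

  -- Otherwise g would map the columns col v 0, …, col v v injectively below v.
  earlier-all : ∀ {b v} → v + D < b → Earlier g b v
  earlier-all {b} {v} v+D<b = decidable-stable (earlier? g b v) λ ¬e →
    let
      col<b : (k : Fin (suc v)) → col v (toℕ k) < b
      col<b k = ≤-<-trans (col-bound (m<1+n⇒m≤n (toℕ<n k))) v+D<b

      below : (k : Fin (suc v)) → g (col v (toℕ k)) < v
      below k = ≤∧≢⇒<
        (minimal (λ (c , c<col , eq) → ¬e (c , <-trans c<col (col<b k) , eq))
                 (col-unblocked v (toℕ k)))
        (λ eq → ¬e (_ , col<b k , eq))
    in n≮n v (injective⇒≤ {f = λ k → fromℕ< (below k)} λ {k} {l} eq →
         toℕ-injective (col-injective {v} (toℕ k) (toℕ l)
           (g-injective (fromℕ<-injective _ _ (below k) (below l) eq))))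

  g-lower : ∀ b → b ≤ g b + D
  g-lower b = ≮⇒≥ λ lt → let _ , b′<b , eq = earlier-all lt in fresh b′<b eq

  earlier-bound : ∀ {b v} → Earlier g b v → v < b + D
  earlier-bound (b′ , b′<b , refl) = ≤-<-trans (g-upper b′) (+-monoˡ-< D b′<b)

  -- Translating the set of used values.

  Shift : ℕ → ℕ → Set
  Shift q b = ∀ v → Earlier g b v ⇔ Earlier g (b + q) (v + q)

  module _ (k : ℕ) where

    private
      q = p * k

    -- Used and blocked values both translate by `q`, so the least available value does too.
    shift⇒periodic : ∀ {b} → n ≤ b → D ≤ b → Shift q b → g (b + q) ≡ g b + q
    shift⇒periodic {b} n≤b D≤b shift = ≤-antisym
      (minimal (λ e → let _ , b′<b , eq = from (shift (g b)) e in fresh b′<b eq)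
               (avoids n≤b ∘ from (blocked-shift k n≤b)))
      (lower-bound (g (b + q)) refl)
      where
      lower-bound : ∀ w → g (b + q) ≡ w → g b + q ≤ w
      lower-bound w eq with q ≤? w
      -- `Shift` says nothing about values below `q`, but `D ≤ b` puts them among the values already
      -- used at column `b + q`.
      ... | no q≰w =
        let _ , b′<b , eq′ = earlier-all (≤-trans (+-monoˡ-< D (≰⇒> q≰w))
              (≤-trans (+-monoʳ-≤ q D≤b) (≤-reflexive (+-comm q b))))
        in contradiction (trans eq′ (sym eq)) (fresh b′<b)
      ... | yes q≤w = subst (g b + q ≤_) v+q≡w (+-monoˡ-≤ q (minimal
        (λ e → let _ , b′<b , eq′ = to (shift v) e
               in fresh b′<b (trans eq′ (trans v+q≡w (sym eq))))
        (λ bl → avoids (m≤n⇒m≤n+o q n≤b)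
          (subst (Blocked f (b + q)) (trans v+q≡w (sym eq)) (to (blocked-shift k n≤b) bl)))))
        where
        v = w ∸ q
        v+q≡w = m∸n+n≡m q≤w

    -- The next column adds `g b` to one set and its translate `g b + q` to the other.
    shift-suc : ∀ {b} → n ≤ b → D ≤ b → Shift q b → Shift q (suc b)
    shift-suc {b} n≤b D≤b shift v = mk⇔
      (earlier-suc⁺ ∘ Sum.map (to (shift v)) (trans eq ∘ cong (_+ q)) ∘ earlier-suc⁻)
      (earlier-suc⁺ ∘ Sum.map (from (shift v)) (+-cancelʳ-≡ q _ _ ∘ trans (sym eq)) ∘ earlier-suc⁻)
      where eq = shift⇒periodic n≤b D≤b shift

    shift-upward : ∀ {b} → n ≤ b → D ≤ b → Shift q b → ∀ d → Shift q (d + b)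
    shift-upward n≤b D≤b shift zero    = shift
    shift-upward n≤b D≤b shift (suc d) = shift-suc (m≤n⇒m≤o+n d n≤b) (m≤n⇒m≤o+n d D≤b)
      (shift-upward n≤b D≤b shift d)

  -- Bit `j` of the window that starts `D` below column `D + c`.
  State : ℕ → ℕ → Set
  State c j = Earlier g (D + c) (c + j)

  -- The `D + D` bits of the window suffice: values below it are used on both sides, values above it
  -- on neither.
  state⇒shift : ∀ q c → (∀ j → j < D + D → State c j ⇔ State (c + q) j) → Shift q (D + c)
  state⇒shift q c states v with c ≤? v
  ... | no c≰v = mk⇔
    (λ _ → earlier-all (≤-trans (s≤s (≤-reflexive v+q+D≡D+v+q))
                         (+-monoˡ-≤ q (+-monoʳ-< D v<c))))
    (λ _ → earlier-all (≤-trans (s≤s (≤-reflexive (+-comm v D)))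
                         (≤-trans (≤-reflexive (sym (+-suc D v))) (+-monoʳ-≤ D v<c))))
    where
    v<c = ≰⇒> c≰v
    v+q+D≡D+v+q : v + q + D ≡ D + v + q
    v+q+D≡D+v+q = trans (+-comm (v + q) D) (sym (+-assoc D v q))
  ... | yes c≤v with j ← v ∸ c | refl ← m+[n∸m]≡n c≤v | j <? D + D
  ...   | yes j<D+D = subst₂ (λ b v → Earlier g (D + c) (c + j) ⇔ Earlier g b v)
            (sym (+-assoc D c q)) (swapʳ c q j) (states j j<D+D)
  ...   | no j≮D+D  = mk⇔
    (λ e → contradiction (earlier-bound e) (≤⇒≯ b+D≤v))
    (λ e → contradiction (earlier-bound e) (≤⇒≯
      (≤-trans (≤-reflexive (swapʳ (D + c) q D)) (+-monoˡ-≤ q b+D≤v))))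
    where
    b+D≡c+2D : ∀ D c → D + c + D ≡ c + (D + D)
    b+D≡c+2D = solve-∀
    b+D≤v : D + c + D ≤ c + j
    b+D≤v = ≤-trans (≤-reflexive (b+D≡c+2D D c)) (+-monoʳ-≤ c (≮⇒≥ j≮D+D))

  eventually-tame : ∃₂ λ n′ k → n ≤ n′ × Tame n′ (p * suc k) D g
  eventually-tame
    -- Sampling at `n + p * t` keeps the columns congruent modulo `p`, so the blocked values
    -- translate as well.
    with i , j , i<j , states ← state-repeats {λ t → State (n + p * t)} (λ _ _ → earlier? g _ _) (D + D)
    with d ← j ∸ suc i | refl ← m+[n∸m]≡n i<j =
    D + c , d , m≤n⇒m≤o+n D n≤c , record
      { upper    = g-upper
      ; lower    = g-lower
      ; periodic = λ b b₀≤b → shift⇒periodic (suc d)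
          (≤-trans (m≤n⇒m≤o+n D n≤c) b₀≤b) (≤-trans (m≤m+n D c) b₀≤b)
          (subst (Shift q) (m∸n+n≡m b₀≤b)
            (shift-upward (suc d) (m≤n⇒m≤o+n D n≤c) (m≤m+n D c) shift (b ∸ (D + c))))
      }
    where
    c = n + p * i
    q = p * suc d
    n≤c = m≤m+n n (p * i)
    c+q : ∀ n p i d → n + p * (suc i + d) ≡ n + p * i + p * suc d
    c+q = solve-∀
    shift : Shift q (D + c)
    shift = state⇒shift q c λ j j<2D →
      subst (λ c′ → State c j ⇔ State c′ j) (c+q n p i d) (states j j<2D)

-- The rows of 2-Star Nim, by induction on the row.

-- (0 , 0) is not a position, so value 0 0 is junk; hence periodicity of row 0 only
-- from column 1 on, and Row.avoids only for columns b ≥ 1.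
value : ℕ → ℕ → ℕ
value zero    zero    = 0
value zero    (suc b) = 𝒢 (position 0 (suc b) λ ())
value (suc a) b       = 𝒢 (position (suc a) b λ ())

value-𝒢 : ∀ a b .(o : NonOrigin a b) → 𝒢 (position a b o) ≡ value a b
value-𝒢 zero    zero    o = contradiction-irr o (λ o → o (refl , refl))
value-𝒢 zero    (suc b) o = refl
value-𝒢 (suc a) b       o = refl

-- With the origin forbidden, row 0 is a Nim heap whose last square is 1.
value-zero-suc : ∀ b → value 0 (suc b) ≡ b
value-zero-suc = <-rec _ λ b rec → ≤-antisym
  (proj₂ (𝒢-spec (position 0 (suc b) λ ())) b λ where
    (position zero zero o , moveʳ _ _ , eq) → contradiction-irr o (λ o → o (refl , refl))
    (position zero (suc b′) _ , moveʳ _ (s≤s b′<b) , eq) → <-irrefl (trans (sym (rec b′<b)) eq) b′<b)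
  (≮⇒≥ λ lt → proj₁ (𝒢-spec (position 0 (suc b) λ ())) (position 0 _ (λ ()) , moveʳ refl (s≤s lt) , rec lt))

tame-zero : Tame 1 1 1 (value 0)
tame-zero = record
  { upper    = upper′
  ; lower    = lower′
  ; periodic = λ { (suc b) _ → trans (value-zero-suc (b + 1)) (cong (_+ 1) (sym (value-zero-suc b))) }
  }
  where
  upper′ : ∀ b → value 0 b ≤ b + 1
  upper′ zero    = z≤n
  upper′ (suc b) = ≤-trans (≤-reflexive (value-zero-suc b)) (m≤n⇒m≤1+n (m≤m+n b 1))

  lower′ : ∀ b → b ≤ value 0 b + 1
  lower′ zero    = z≤n
  lower′ (suc b) = ≤-reflexive (trans (+-comm 1 b) (cong (_+ 1) (sym (value-zero-suc b))))

module Row (a : ℕ) where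

  below : ∃ (_≤ a) → ℕ → ℕ
  below (i , _) = value i

  fresh : ∀ {b′ b} → b′ < b → value (suc a) b′ ≢ value (suc a) b
  fresh {b = b} b′<b eq = proj₁ (𝒢-spec (position (suc a) b λ ())) (position (suc a) _ (λ ()) , moveʳ refl b′<b , eq)

  avoids : ∀ {b} → 1 ≤ b → ¬ Blocked below b (value (suc a) b)
  avoids {b} b≥1 ((i , i≤a) , eq) =
    proj₁ (𝒢-spec (position (suc a) b λ ())) (position i b o , moveˡ (s≤s i≤a) refl , trans (value-𝒢 i b o) eq)
    where
    o : NonOrigin i b
    o (_ , refl) = contradiction b≥1 λ ()

  -- At column 0 the junk entry `value 0 0` counts as blocked; this only strengthens the assumption
  -- on `v`, so the bound holds there too.
  minimal : ∀ {b v} → ¬ Earlier (value (suc a)) b v → ¬ Blocked below b v → value (suc a) b ≤ v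
  minimal {b} {v} ¬e ¬bl = proj₂ (𝒢-spec (position (suc a) b λ ())) v λ where
    (position i _ o , moveˡ (s≤s i≤a) refl , eq) → ¬bl ((i , i≤a) , trans (sym (value-𝒢 i b o)) eq)
    (position _ b′ _ , moveʳ refl b′<b , eq)     → ¬e (b′ , b′<b , eq)

-- One triple for all rows up to `a` is what `Greedy` requires to build row `suc a`.
rows-tame : ∀ a → ∃[ n ] ∃[ p ] ∃[ K ] (1 ≤ n × 1 ≤ p × (∀ i → i ≤ a → Tame n p K (value i)))
rows-tame zero = 1 , 1 , 1 , ≤-refl , ≤-refl , λ { zero z≤n → tame-zero }
rows-tame (suc a) with n , p , K , 1≤n , 1≤p , tame ← rows-tame a =
  let
    open Row a
    open Greedy {f = below} (λ (i , i≤a) → tame i i≤a) (value (suc a))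
      fresh (λ n≤b → avoids (≤-trans 1≤n n≤b)) minimal
    n′ , k , n≤n′ , tame′ = eventually-tame
  in n′ , p * suc k , D , ≤-trans 1≤n n≤n′ , *-mono-≤ 1≤p (s≤s z≤n) ,
    λ i i≤1+a → case m≤n⇒m<n∨m≡n i≤1+a of λ where
      (inj₁ (s≤s i≤a)) → tame-weaken (suc k) n≤n′ (<⇒≤ K<D) (tame i i≤a)
      (inj₂ refl)      → tame′

theorem5 : (a : ℕ) (a>0 : a > 0) →
    ∃[ n₀ ] ∃[ p ] (n₀ ≥ a × p ≥ 1 ×
    (∀ b → b ≥ n₀ →
    𝒢 (position a (b + p) (a>0⇒nonOrigin a>0))
    ≡ 𝒢 (position a b (a>0⇒nonOrigin a>0)) + p))
theorem5 (suc a) _ =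
  let n , p , K , _ , 1≤p , tame = rows-tame (suc a)
  -- Adding `suc a` to the start ensures `n₀ ≥ a`.
  in suc a + n , p , m≤m+n (suc a) n , 1≤p ,
     λ b b≥n₀ → periodic (tame (suc a) ≤-refl) b (m+n≤o⇒n≤o (suc a) b≥n₀)
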